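{- If $\alpha\in[1/2,1]$ and $\mathcal{P}$ is polynomially solvable, then $\textsc{Min-Hurwicz}~\mathcal{P}$ is approximable within $\alpha K+(1-\alpha)(K-2)$, where $K\ge2$ is the number of scenarios.
   Context: A combinatorial optimization problem $\mathcal{P}$: each instance specifies a finite set of elements $E=\{e_1,\dots,e_n\}$, a set of feasible solutions $\Phi\subseteq 2^E$ (typically described implicitly), and a nonnegative cost $c_i$ for each $e_i\in E$; one seeks $X\in\Phi$ minimizing $\sum_{e_i\in X}c_i$. $\mathcal{P}$ is polynomially solvable if an optimal solution can be computed in polynomial time for all nonnegative costs. $\textsc{Min-Hurwicz}~\mathcal{P}$: instead of a single cost vector one is given a scenario set $\Gamma=\{\pmb{c}_1,\dots,\pmb{c}_K\}$ of $K$ distinct cost scenarios $\pmb{c}_j=(c_{1j},\dots,c_{nj})$ with nonnegative entries ($K$ may be part of the input); with $F(X,\pmb{c}_j)=\sum_{e_i\in X}c_{ij}$ and a fixed $\alpha\in[0,1]$, one minimizes $\alpha\max_{j}F(X,\pmb{c}_j)+(1-\alpha)\min_{j}F(X,\pmb{c}_j)$ over $X\in\Phi$. A minimization problem is approximable within $\rho$ if there is a polynomial-time algorithm that on each instance returns a feasible solution whose objective value is at most $\rho$ times the optimal value. -}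

module Defs where

open import Data.Fin.Subset using (Subset; inside; outside)
open import Data.Integer.Base using (+_; ∣_∣)
open import Data.List.Base using (List; []; _∷_)
open import Data.Nat.Base as ℕ using (ℕ; suc; ⌊_/2⌋)
open import Data.Nat.Logarithm using (⌊log₂_⌋)
import Data.Nat.Properties as ℕ
open import Data.Product.Base using (Σ; ∃; _×_; _,_; proj₁; proj₂)
open import Data.Rational.Unnormalised.Base as ℚ
  using (ℚᵘ; 0ℚᵘ; 1ℚᵘ; ½; ↥_; ↧ₙ_; Positive; positive; _≃_)
import Data.Rational.Unnormalised.Properties as ℚ
open import Data.Rational.Unnormalised.Solver using (module +-*-Solver)
open import Data.Vec.Base as Vec using (Vec; []; _∷_; foldr₁; toList)
open import Data.Vec.Relation.Binary.Pointwise.Inductive using (Pointwise)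
open import Data.Vec.Relation.Unary.All using (All)
open import Data.Vec.Relation.Unary.AllPairs using (AllPairs)
open import Relation.Nullary using (¬_)
open import Relation.Binary.PropositionalEquality.Core using (refl)

------------------------------------------------------------------------
-- Real numbers, as Cauchy sequences of rationals

record ℝ : Set where
  constructor mkℝ
  field
    seq    : ℕ → ℚᵘ
    cauchy : ∀ ε → 0ℚᵘ ℚ.< ε →
             ∃ λ N → ∀ {m n} → N ℕ.≤ m → N ℕ.≤ n →
             ℚ.∣ seq m ℚ.- seq n ∣ ℚ.≤ ε

open ℝ public

infix  4 _≤ᴿ_
infixl 6 _+ᴿ_ _-ᴿ_
infixl 7 _*ᴿ_
infix  8 -ᴿ_

_≤ᴿ_ : ℝ → ℝ → Set
x ≤ᴿ y = ∀ ε → 0ℚᵘ ℚ.< ε →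
         ∃ λ N → ∀ {n} → N ℕ.≤ n → seq x n ℚ.≤ seq y n ℚ.+ ε

fromℚ : ℚᵘ → ℝ
fromℚ q = mkℝ (λ _ → q) λ ε 0<ε → 0 , λ _ _ → begin
  ℚ.∣ q ℚ.- q ∣ ≃⟨ ℚ.∣-∣-cong (ℚ.+-inverseʳ q) ⟩
  0ℚᵘ           <⟨ 0<ε ⟩
  ε             ∎
  where open ℚ.≤-Reasoning

fromℕ : ℕ → ℝ
fromℕ n = fromℚ (+ n ℚ./ 1)

0<½* : ∀ {ε} → 0ℚᵘ ℚ.< ε → 0ℚᵘ ℚ.< ½ ℚ.* ε
0<½* {ε} 0<ε = ℚ.<-respˡ-≃ (ℚ.*-zeroʳ ½) (ℚ.*-monoʳ-<-pos ½ 0<ε)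

_+ᴿ_ : ℝ → ℝ → ℝ
x +ᴿ y = mkℝ (λ n → seq x n ℚ.+ seq y n) λ ε 0<ε →
  let (M , p) = cauchy x (½ ℚ.* ε) (0<½* 0<ε)
      (N , q) = cauchy y (½ ℚ.* ε) (0<½* 0<ε)
  in M ℕ.⊔ N , λ {m} {n} i j →
    let a = seq x m ; b = seq x n ; c = seq y m ; d = seq y n in begin
    ℚ.∣ a ℚ.+ c ℚ.- (b ℚ.+ d) ∣              ≃⟨ ℚ.∣-∣-cong (rearrange a b c d) ⟩
    ℚ.∣ (a ℚ.- b) ℚ.+ (c ℚ.- d) ∣            ≤⟨ ℚ.∣p+q∣≤∣p∣+∣q∣ (a ℚ.- b) (c ℚ.- d) ⟩
    ℚ.∣ a ℚ.- b ∣ ℚ.+ ℚ.∣ c ℚ.- d ∣          ≤⟨ ℚ.+-mono-≤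
                                                  (p (ℕ.m⊔n≤o⇒m≤o M N i) (ℕ.m⊔n≤o⇒m≤o M N j))
                                                  (q (ℕ.m⊔n≤o⇒n≤o M N i) (ℕ.m⊔n≤o⇒n≤o M N j)) ⟩
    ½ ℚ.* ε ℚ.+ ½ ℚ.* ε                      ≃⟨ ℚ.*-distribʳ-+ ε ½ ½ ⟨
    (½ ℚ.+ ½) ℚ.* ε                          ≃⟨ ℚ.*-congʳ {ε} {½ ℚ.+ ½} {1ℚᵘ} (ℚ.*≡* refl) ⟩
    1ℚᵘ ℚ.* ε                                ≃⟨ ℚ.*-identityˡ ε ⟩
    ε                                        ∎
  where
  open ℚ.≤-Reasoning
  rearrange : ∀ a b c d → a ℚ.+ c ℚ.- (b ℚ.+ d) ≃ (a ℚ.- b) ℚ.+ (c ℚ.- d)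
  rearrange = solve 4 (λ a b c d →
    a :+ c :- (b :+ d) := (a :- b) :+ (c :- d)) ℚ.≃-refl
    where open +-*-Solver

-ᴿ_ : ℝ → ℝ
-ᴿ x = mkℝ (λ n → ℚ.- seq x n) λ ε 0<ε →
  let (N , p) = cauchy x ε 0<ε in N , λ {m} {n} i j →
    let a = seq x m ; b = seq x n in begin
    ℚ.∣ ℚ.- a ℚ.- ℚ.- b ∣ ≃⟨ ℚ.∣-∣-cong (rearrange a b) ⟩
    ℚ.∣ ℚ.- (a ℚ.- b) ∣   ≃⟨ ℚ.∣-p∣≃∣p∣ (a ℚ.- b) ⟩
    ℚ.∣ a ℚ.- b ∣         ≤⟨ p i j ⟩
    ε                     ∎
  where
  open ℚ.≤-Reasoning
  rearrange : ∀ a b → ℚ.- a ℚ.- ℚ.- b ≃ ℚ.- (a ℚ.- b)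
  rearrange = solve 2 (λ a b → :- a :- :- b := :- (a :- b)) ℚ.≃-refl
    where open +-*-Solver

_-ᴿ_ : ℝ → ℝ → ℝ
x -ᴿ y = x +ᴿ -ᴿ y

eventuallyBounded : ∀ x → ∃ λ B → 0ℚᵘ ℚ.< B ×
  ∃ λ N → ∀ {n} → N ℕ.≤ n → ℚ.∣ seq x n ∣ ℚ.≤ B
eventuallyBounded x with N , p ← cauchy x 1ℚᵘ (ℚ.positive⁻¹ 1ℚᵘ) =
  1ℚᵘ ℚ.+ ℚ.∣ b ∣ ,
  ℚ.<-≤-trans (ℚ.positive⁻¹ 1ℚᵘ)
    (ℚ.≤-respˡ-≃ (ℚ.+-identityʳ 1ℚᵘ) (ℚ.+-monoʳ-≤ 1ℚᵘ (ℚ.0≤∣p∣ b))) ,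
  N , λ {n} i → let a = seq x n in begin
    ℚ.∣ a ∣                   ≃⟨ ℚ.∣-∣-cong (rearrange a b) ⟩
    ℚ.∣ (a ℚ.- b) ℚ.+ b ∣     ≤⟨ ℚ.∣p+q∣≤∣p∣+∣q∣ (a ℚ.- b) b ⟩
    ℚ.∣ a ℚ.- b ∣ ℚ.+ ℚ.∣ b ∣ ≤⟨ ℚ.+-monoˡ-≤ ℚ.∣ b ∣ (p i ℕ.≤-refl) ⟩
    1ℚᵘ ℚ.+ ℚ.∣ b ∣           ∎
  where
  open ℚ.≤-Reasoning
  b = seq x N
  rearrange : ∀ a b → a ≃ (a ℚ.- b) ℚ.+ b
  rearrange = solve 2 (λ a b → a := (a :- b) :+ b) ℚ.≃-refl
    where open +-*-Solver

∣-∣*-mono : ∀ p q {r s} → ℚ.∣ p ∣ ℚ.≤ r → ℚ.∣ q ∣ ℚ.≤ s → ℚ.∣ p ℚ.* q ∣ ℚ.≤ r ℚ.* s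
∣-∣*-mono p q {r} {s} i j = begin
  ℚ.∣ p ℚ.* q ∣         ≃⟨ ℚ.∣p*q∣≃∣p∣*∣q∣ p q ⟩
  ℚ.∣ p ∣ ℚ.* ℚ.∣ q ∣   ≤⟨ ℚ.*-mono-≤-nonNeg
                            {{ℚ.nonNegative (ℚ.0≤∣p∣ p)}} {{ℚ.nonNegative (ℚ.0≤∣p∣ q)}} i j ⟩
  r ℚ.* s               ∎
  where open ℚ.≤-Reasoning

_*ᴿ_ : ℝ → ℝ → ℝ
x *ᴿ y = mkℝ (λ n → seq x n ℚ.* seq y n) isCauchy
  where
  open ℚ.≤-Reasoning

  rearrange : ∀ a b c d →
    a ℚ.* c ℚ.- b ℚ.* d ≃ a ℚ.* (c ℚ.- d) ℚ.+ d ℚ.* (a ℚ.- b)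
  rearrange = solve 4 (λ a b c d →
    a :* c :- b :* d := a :* (c :- d) :+ d :* (a :- b)) ℚ.≃-refl
    where open +-*-Solver

  isCauchy : ∀ ε → 0ℚᵘ ℚ.< ε → ∃ λ N → ∀ {m n} → N ℕ.≤ m → N ℕ.≤ n →
    ℚ.∣ seq x m ℚ.* seq y m ℚ.- seq x n ℚ.* seq y n ∣ ℚ.≤ ε
  isCauchy ε 0<ε
    with A , 0<A , N₁ , p₁ ← eventuallyBounded x
       | B , 0<B , N₂ , p₂ ← eventuallyBounded y
    = (N₁ ℕ.⊔ N₂) ℕ.⊔ (N₃ ℕ.⊔ N₄) , λ {m} {n} i j →
    let a = seq x m ; b = seq x n ; c = seq y m ; d = seq y n
        i₁ = ℕ.m⊔n≤o⇒m≤o N₁ N₂ (ℕ.m⊔n≤o⇒m≤o (N₁ ℕ.⊔ N₂) _ i)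
        j₂ = ℕ.m⊔n≤o⇒n≤o N₁ N₂ (ℕ.m⊔n≤o⇒m≤o (N₁ ℕ.⊔ N₂) _ j)
        i′ = ℕ.m⊔n≤o⇒n≤o (N₁ ℕ.⊔ N₂) _ i
        j′ = ℕ.m⊔n≤o⇒n≤o (N₁ ℕ.⊔ N₂) _ j
    in begin
    ℚ.∣ a ℚ.* c ℚ.- b ℚ.* d ∣
      ≃⟨ ℚ.∣-∣-cong (rearrange a b c d) ⟩
    ℚ.∣ a ℚ.* (c ℚ.- d) ℚ.+ d ℚ.* (a ℚ.- b) ∣
      ≤⟨ ℚ.∣p+q∣≤∣p∣+∣q∣ (a ℚ.* (c ℚ.- d)) (d ℚ.* (a ℚ.- b)) ⟩
    ℚ.∣ a ℚ.* (c ℚ.- d) ∣ ℚ.+ ℚ.∣ d ℚ.* (a ℚ.- b) ∣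
      ≤⟨ ℚ.+-mono-≤
           (∣-∣*-mono a (c ℚ.- d) (p₁ i₁)
             (p₄ (ℕ.m⊔n≤o⇒n≤o N₃ N₄ i′) (ℕ.m⊔n≤o⇒n≤o N₃ N₄ j′)))
           (∣-∣*-mono d (a ℚ.- b) (p₂ j₂)
             (p₃ (ℕ.m⊔n≤o⇒m≤o N₃ N₄ i′) (ℕ.m⊔n≤o⇒m≤o N₃ N₄ j′))) ⟩
    A ℚ.* δ ℚ.+ B ℚ.* δ             ≃⟨ ℚ.*-distribʳ-+ δ A B ⟨
    C ℚ.* (ℚ.1/ C ℚ.* ε)            ≃⟨ ℚ.*-assoc C (ℚ.1/ C) ε ⟨
    C ℚ.* ℚ.1/ C ℚ.* ε              ≃⟨ ℚ.*-congʳ (ℚ.*-inverseʳ C) ⟩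
    1ℚᵘ ℚ.* ε                       ≃⟨ ℚ.*-identityˡ ε ⟩
    ε                               ∎
    where
    C = A ℚ.+ B
    instance
      C-pos : Positive C
      C-pos = positive (ℚ.+-mono-< 0<A 0<B)
      C-nonZero : ℚ.NonZero C
      C-nonZero = ℚ.pos⇒nonZero C
      1/C-pos : Positive (ℚ.1/ C)
      1/C-pos = ℚ.1/pos⇒pos C
    δ = ℚ.1/ C ℚ.* ε
    0<δ : 0ℚᵘ ℚ.< δ
    0<δ = ℚ.<-respˡ-≃ (ℚ.*-zeroʳ (ℚ.1/ C)) (ℚ.*-monoʳ-<-pos (ℚ.1/ C) 0<ε)
    N₃ = proj₁ (cauchy x δ 0<δ)
    p₃ = proj₂ (cauchy x δ 0<δ)
    N₄ = proj₁ (cauchy y δ 0<δ)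
    p₄ = proj₂ (cauchy y δ 0<δ)

------------------------------------------------------------------------
-- Polynomial time
--
-- The machine model is a point-free WHILE language on binary trees (Jones,
-- "Computability and Complexity from a Programming Perspective") whose
-- leaves hold natural numbers under the logarithmic cost criterion.
-- Structural operations take unit time, because a tree is represented by a
-- pointer to a shared cell; arithmetic is charged by the binary length of
-- the operands.  On outputs of polynomial size, polynomial time in this
-- model is polynomial time on Turing machines.

data Tree : Set where
  leaf : ℕ → Tree
  node : Tree → Tree → Tree

bits : ℕ → ℕ
bits n = suc ⌊log₂ n ⌋

size : Tree → ℕ
size (leaf n)   = bits n
size (node x y) = suc (size x ℕ.+ size y)

infixl 5 _⨾_

data Program : Set where
  skip              : Program
  const             : ℕ → Program
  _⨾_               : Program → Program → Program
  ⟨_,_⟩             : Program → Program → Program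
  fst snd           : Program
  leaf?             : Program
  add sub mul half  : Program
  if_then_else_     : Program → Program → Program → Program
  while_loop_       : Program → Program → Program

-- p ⊢ x ⇓ y ∣ t : run on x, the program p halts with y after time t.
-- Guards are false on leaf 0 and true on the other leaves.

infix 4 _⊢_⇓_∣_

data _⊢_⇓_∣_ : Program → Tree → Tree → ℕ → Set where
  ⇓skip   : ∀ {x} → skip ⊢ x ⇓ x ∣ 1
  ⇓const  : ∀ {k x} → const k ⊢ x ⇓ leaf k ∣ 1
  ⇓seq    : ∀ {p q x y z s t} → p ⊢ x ⇓ y ∣ s → q ⊢ y ⇓ z ∣ t →
            p ⨾ q ⊢ x ⇓ z ∣ suc (s ℕ.+ t)
  ⇓pair   : ∀ {p q x y z s t} → p ⊢ x ⇓ y ∣ s → q ⊢ x ⇓ z ∣ t →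
            ⟨ p , q ⟩ ⊢ x ⇓ node y z ∣ suc (s ℕ.+ t)
  ⇓fst    : ∀ {x y} → fst ⊢ node x y ⇓ x ∣ 1
  ⇓snd    : ∀ {x y} → snd ⊢ node x y ⇓ y ∣ 1
  ⇓leaf   : ∀ {n} → leaf? ⊢ leaf n ⇓ leaf 1 ∣ 1
  ⇓node   : ∀ {x y} → leaf? ⊢ node x y ⇓ leaf 0 ∣ 1
  ⇓add    : ∀ {m n} → add ⊢ node (leaf m) (leaf n) ⇓ leaf (m ℕ.+ n) ∣ bits m ℕ.+ bits n
  ⇓sub    : ∀ {m n} → sub ⊢ node (leaf m) (leaf n) ⇓ leaf (m ℕ.∸ n) ∣ bits m ℕ.+ bits n
  ⇓mul    : ∀ {m n} → mul ⊢ node (leaf m) (leaf n) ⇓ leaf (m ℕ.* n) ∣ bits m ℕ.+ bits n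
  ⇓half   : ∀ {n} → half ⊢ leaf n ⇓ leaf ⌊ n /2⌋ ∣ bits n
  ⇓then   : ∀ {b p q x y k s t} → b ⊢ x ⇓ leaf (suc k) ∣ s → p ⊢ x ⇓ y ∣ t →
            if b then p else q ⊢ x ⇓ y ∣ suc (s ℕ.+ t)
  ⇓else   : ∀ {b p q x y s t} → b ⊢ x ⇓ leaf 0 ∣ s → q ⊢ x ⇓ y ∣ t →
            if b then p else q ⊢ x ⇓ y ∣ suc (s ℕ.+ t)
  ⇓stop   : ∀ {b p x s} → b ⊢ x ⇓ leaf 0 ∣ s →
            while b loop p ⊢ x ⇓ x ∣ suc s
  ⇓loop   : ∀ {b p x y z k s t u} → b ⊢ x ⇓ leaf (suc k) ∣ s → p ⊢ x ⇓ y ∣ t →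
            while b loop p ⊢ y ⇓ z ∣ u →
            while b loop p ⊢ x ⇓ z ∣ suc (s ℕ.+ t ℕ.+ u)

encodeList : ∀ {A : Set} → (A → Tree) → List A → Tree
encodeList f []       = leaf 0
encodeList f (x ∷ xs) = node (f x) (encodeList f xs)

encodeVec : ∀ {A : Set} {n} → (A → Tree) → Vec A n → Tree
encodeVec f xs = encodeList f (toList xs)

encodeSubset : ∀ {n} → Subset n → Tree
encodeSubset = encodeVec λ where
  outside → leaf 0
  inside  → leaf 1

-- A numerator-denominator pair, not necessarily in lowest terms; the sign
-- is omitted because only nonnegative rationals get encoded.
encodeCost : ℚᵘ → Tree
encodeCost q = node (leaf ∣ ↥ q ∣) (leaf (↧ₙ q))

------------------------------------------------------------------------
-- Minimization over families of subsets of a finite set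

record MinimizationProblem : Set₁ where
  field
    Instance  : Set
    encode    : Instance → Tree
    elements  : Instance → ℕ
    Feasible  : ∀ I → Subset (elements I) → Set
    objective : ∀ I → Subset (elements I) → ℝ

module _ (Q : MinimizationProblem) where
  open MinimizationProblem Q

  PolynomialTimeFor : (∀ I → Subset (elements I) → Set) → Set
  PolynomialTimeFor Good =
    Σ Program λ p → ∃ λ c → ∃ λ d → ∀ I →
    ∃ λ X → Good I X × ∃ λ t →
      p ⊢ encode I ⇓ encodeSubset X ∣ t × t ℕ.≤ c ℕ.* size (encode I) ℕ.^ d

  Optimal : ∀ I → Subset (elements I) → Set
  Optimal I X = Feasible I X × (∀ Y → Feasible I Y → objective I X ≤ᴿ objective I Y)

  -- Comparing with every feasible Y, rather than only with an optimal one,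
  -- avoids presupposing that a minimum of reals can be located constructively.
  Within : (Instance → ℝ) → ∀ I → Subset (elements I) → Set
  Within ρ I X =
    Feasible I X × (∀ Y → Feasible I Y → objective I X ≤ᴿ ρ I *ᴿ objective I Y)

  PolynomiallySolvable : Set
  PolynomiallySolvable = PolynomialTimeFor Optimal

  ApproximableWithin : (Instance → ℝ) → Set
  ApproximableWithin ρ = PolynomialTimeFor (Within ρ)

------------------------------------------------------------------------
-- Combinatorial optimization problems and their Hurwicz versions

-- A Structure is an instance without its costs: it specifies E = Fin (∣E∣ S)
-- and, implicitly, Φ S.
record CombinatorialProblem : Set₁ where
  field
    Structure       : Set
    encodeStructure : Structure → Tree
    ∣E∣             : Structure → ℕ
    Φ               : ∀ S → Subset (∣E∣ S) → Set

F : ∀ {n} → Subset n → Vec ℚᵘ n → ℚᵘ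
F []            []       = 0ℚᵘ
F (inside  ∷ X) (c ∷ cs) = c ℚ.+ F X cs
F (outside ∷ X) (c ∷ cs) = F X cs

NonNegativeCosts : ∀ {n} → Vec ℚᵘ n → Set
NonNegativeCosts = All (0ℚᵘ ℚ.≤_)

maximum minimum : ∀ {k} → Vec ℚᵘ (suc k) → ℚᵘ
maximum = foldr₁ ℚ._⊔_
minimum = foldr₁ ℚ._⊓_

hurwicz : ∀ {n k} → ℝ → Vec (Vec ℚᵘ n) (suc k) → Subset n → ℝ
hurwicz α Γ X =
  α *ᴿ fromℚ (maximum costs) +ᴿ (fromℕ 1 -ᴿ α) *ᴿ fromℚ (minimum costs)
  where costs = Vec.map (F X) Γ

module _ (P : CombinatorialProblem) where
  open CombinatorialProblem P

  record DeterministicInstance : Set where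
    field
      structure   : Structure
      costs       : Vec ℚᵘ (∣E∣ structure)
      nonNegative : NonNegativeCosts costs

  deterministic : MinimizationProblem
  deterministic = record
    { Instance  = DeterministicInstance
    ; encode    = λ I → let open DeterministicInstance I in
                    node (encodeStructure structure) (encodeVec encodeCost costs)
    ; elements  = λ I → ∣E∣ (DeterministicInstance.structure I)
    ; Feasible  = λ I → Φ (DeterministicInstance.structure I)
    ; objective = λ I X → fromℚ (F X (DeterministicInstance.costs I))
    }

  record ScenarioInstance : Set where
    field
      structure   : Structure
      K-2         : ℕ

    K : ℕ
    K = 2 ℕ.+ K-2

    field
      Γ           : Vec (Vec ℚᵘ (∣E∣ structure)) K
      nonNegative : All NonNegativeCosts Γ
      distinct    : AllPairs (λ c c′ → ¬ Pointwise _≃_ c c′) Γ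

  minHurwicz : ℝ → MinimizationProblem
  minHurwicz α = record
    { Instance  = ScenarioInstance
    ; encode    = λ I → let open ScenarioInstance I in
                    node (encodeStructure structure) (encodeVec (encodeVec encodeCost) Γ)
    ; elements  = λ I → ∣E∣ (ScenarioInstance.structure I)
    ; Feasible  = λ I → Φ (ScenarioInstance.structure I)
    ; objective = λ I → hurwicz α (ScenarioInstance.Γ I)
    }

  scenarioCount : ScenarioInstance → ℕ
  scenarioCount = ScenarioInstance.K

{-# OPTIONS --safe #-}

-- Let X be optimal for the sum of the K scenarios and Y any feasible solution,
-- and let M, m and M′, m′ be the largest and smallest scenario costs of X and
-- of Y.  Then M + (K-1) m ≤ sum of costs of X ≤ sum of costs of Y
-- ≤ (K-1) M′ + m′, and the claim follows from the identity
--     (K - 2 + 2α) (α M′ + (1-α) m′) - (α M + (1-α) m)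
--   = α ((K-1) M′ + m′ - (M + (K-1) m)) + ((K-2) α + 2α - 1) m
--     + α (2α - 1) (M′ - m′) + (K-2) (1-α) m′.
-- Since α is a real number, its approximations satisfy ½ ≤ α ≤ 1 only up to
-- some δ, whose contribution is controlled separately.  Denominators multiply
-- along the sum of the scenarios, so its binary length is at most linear in
-- that of the input.

module Submission where

open import Defs
open import Data.Fin.Subset using (Subset; inside; outside)
open import Data.Nat.Base as ℕ using (ℕ; zero; suc)
import Data.Nat.Properties as ℕ
open import Data.Product.Base using (∃; _×_; _,_; proj₁)
open import Data.Rational.Unnormalised.Base as ℚ using (ℚᵘ; 0ℚᵘ; mkℚᵘ; ↥_; ↧ₙ_; ½)
open import Data.Vec.Base as Vec using (Vec; []; _∷_; zipWith; toList)
open import Data.Vec.Relation.Unary.All as All using (All; []; _∷_)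
open import Function.Base using (_∘_)
open import Relation.Binary.PropositionalEquality

-- A left fold with an accumulator, so that each of its steps is one round of the loop
-- `fold addRows`.
sumCosts : ∀ {n k} → Vec ℚᵘ n → Vec (Vec ℚᵘ n) k → Vec ℚᵘ n
sumCosts = Vec.foldl′ λ acc c → zipWith ℚ._+_ c acc

module Aggregation where
  open import Data.Integer.Base as ℤ using (∣_∣; -[1+_])
  import Data.Integer.Properties as ℤ
  open import Data.List.Base as List using (List; []; _∷_; length; _ʳ++_)
  open import Data.List.Properties using (reverse-involutive; length-reverse)
  open import Data.Nat.Base
  open import Data.Nat.Logarithm
  open import Data.Nat.Properties
  open import Data.Nat.Tactic.RingSolver using (solve-∀)
  import Data.Rational.Unnormalised.Properties as ℚ
  open import Data.Vec.Properties using (length-toList)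

  -- Binary lengths of sums and products

  n<2^bits : ∀ n → n < 2 ^ bits n
  n<2^bits n = ≰⇒> λ 2^b≤n → 1+n≰n (begin
    bits n               ≡⟨ ⌊log₂[2^n]⌋≡n (bits n) ⟨
    ⌊log₂ 2 ^ bits n ⌋   ≤⟨ ⌊log₂⌋-mono-≤ 2^b≤n ⟩
    ⌊log₂ n ⌋            ∎)
    where open ≤-Reasoning

  bits-mono : ∀ {m n} → m ≤ n → bits m ≤ bits n
  bits-mono m≤n = s≤s (⌊log₂⌋-mono-≤ m≤n)

  bits-≤2^ : ∀ {n k} → n ≤ 2 ^ k → bits n ≤ suc k
  bits-≤2^ {n} {k} n≤2^k = begin
    bits n         ≤⟨ bits-mono n≤2^k ⟩
    bits (2 ^ k)   ≡⟨ cong suc (⌊log₂[2^n]⌋≡n k) ⟩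
    suc k          ∎
    where open ≤-Reasoning

  bits-* : ∀ m n → bits (m * n) ≤ suc (bits m + bits n)
  bits-* m n = bits-≤2^ (begin
    m * n                     ≤⟨ *-mono-≤ (<⇒≤ (n<2^bits m)) (<⇒≤ (n<2^bits n)) ⟩
    2 ^ bits m * 2 ^ bits n   ≡⟨ ^-distribˡ-+-* 2 (bits m) (bits n) ⟨
    2 ^ (bits m + bits n)     ∎)
    where open ≤-Reasoning

  -- Since `bits` is one more than the logarithm, both operands are at most
  -- `2 ^ (bits m + ⌊log₂ n ⌋)`; doubling raises the exponent to `bits m + bits n`.
  bits-+ : ∀ m n → bits (m + n) ≤ suc (bits m + bits n)
  bits-+ m n = bits-≤2^ (begin
    m + n                                         ≤⟨ +-mono-≤ (<⇒≤ (n<2^bits m)) (<⇒≤ (n<2^bits n)) ⟩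
    2 ^ bits m + 2 ^ bits n                       ≤⟨ +-mono-≤ (^-monoʳ-≤ 2 (m≤m+n (bits m) ⌊log₂ n ⌋))
                                                              (^-monoʳ-≤ 2 (m≤n+m (bits n) ⌊log₂ m ⌋)) ⟩
    2 ^ (bits m + b) + 2 ^ (⌊log₂ m ⌋ + bits n)   ≡⟨ cong (λ k → 2 ^ (bits m + b) + 2 ^ k) (+-suc ⌊log₂ m ⌋ b) ⟩
    2 ^ (bits m + b) + 2 ^ (bits m + b)           ≡⟨ cong (2 ^ (bits m + b) +_) (+-identityʳ _) ⟨
    2 ^ suc (bits m + b)                          ≡⟨ cong (2 ^_) (+-suc (bits m) b) ⟨
    2 ^ (bits m + bits n)                         ∎)
    where
    open ≤-Reasoning
    b = ⌊log₂ n ⌋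

  -- The closing `leaf 0` makes the inequality strict, which pays for the exit round counted by
  -- `suc n` in `loop-bound`.
  length<size : ∀ {A : Set} {n} (f : A → Tree) (xs : Vec A n) → n < size (encodeVec f xs)
  length<size f []       = s≤s z≤n
  length<size f (x ∷ xs) = s≤s (≤-trans (length<size f xs) (m≤n+m _ (size (f x))))

  -- Running times of composed programs and of list folds

  -- Running times are measured in multiples k of a unit B, so that the
  -- coefficients of loop-free programs are closed numerals.
  infix 4 _⊢_⇓_within_·_

  record _⊢_⇓_within_·_ (p : Program) (x y : Tree) (k B : ℕ) : Set where
    constructor _,_
    field
      {time} : ℕ
      run    : p ⊢ x ⇓ y ∣ time
      bound  : time ≤ k * B

  isNode : Program
  isNode = if leaf? then const 0 else const 1

  -- Maps (list, acc) to ([], result), where p maps (head, acc) to the next acc.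
  fold : Program → Program
  fold p = while fst ⨾ isNode loop ⟨ fst ⨾ snd , ⟨ fst ⨾ fst , snd ⟩ ⨾ p ⟩

  module _ {B : ℕ} .{{_ : NonZero B}} where
    open ≤-Reasoning

    private
      1≤B : 1 ≤ 1 * B
      1≤B = ≤-trans (>-nonZero⁻¹ B) (≤-reflexive (sym (*-identityˡ B)))

      +-bound : ∀ {s t k l} → s ≤ k * B → t ≤ l * B → s + t ≤ (k + l) * B
      +-bound {k = k} {l} s≤ t≤ = ≤-trans (+-mono-≤ s≤ t≤) (≤-reflexive (sym (*-distribʳ-+ B k l)))

      suc-+-bound : ∀ {s t k l} → s ≤ k * B → t ≤ l * B → suc (s + t) ≤ suc (k + l) * B
      suc-+-bound {k = k} {l} s≤ t≤ = +-mono-≤ (>-nonZero⁻¹ B) (+-bound {k = k} {l} s≤ t≤)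

    skip! : ∀ {x} → skip ⊢ x ⇓ x within 1 · B
    skip! = ⇓skip , 1≤B

    const! : ∀ {c x} → const c ⊢ x ⇓ leaf c within 1 · B
    const! = ⇓const , 1≤B

    fst! : ∀ {x y} → fst ⊢ node x y ⇓ x within 1 · B
    fst! = ⇓fst , 1≤B

    snd! : ∀ {x y} → snd ⊢ node x y ⇓ y within 1 · B
    snd! = ⇓snd , 1≤B

    infixl 5 _⨾!_

    _⨾!_ : ∀ {p q x y z k l} → p ⊢ x ⇓ y within k · B → q ⊢ y ⇓ z within l · B →
           p ⨾ q ⊢ x ⇓ z within suc (k + l) · B
    _⨾!_ {k = k} {l} (r , b) (r′ , b′) = ⇓seq r r′ , suc-+-bound {k = k} {l} b b′

    ⟨_,_⟩! : ∀ {p q x y z k l} → p ⊢ x ⇓ y within k · B → q ⊢ x ⇓ z within l · B →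
             ⟨ p , q ⟩ ⊢ x ⇓ node y z within suc (k + l) · B
    ⟨_,_⟩! {k = k} {l} (r , b) (r′ , b′) = ⇓pair r r′ , suc-+-bound {k = k} {l} b b′

    add! : ∀ {m n k l} → bits m ≤ k * B → bits n ≤ l * B →
           add ⊢ node (leaf m) (leaf n) ⇓ leaf (m + n) within k + l · B
    add! {k = k} {l} i j = ⇓add , +-bound {k = k} {l} i j

    mul! : ∀ {m n k l} → bits m ≤ k * B → bits n ≤ l * B →
           mul ⊢ node (leaf m) (leaf n) ⇓ leaf (m * n) within k + l · B
    mul! {k = k} {l} i j = ⇓mul , +-bound {k = k} {l} i j

    isNode-leaf : ∀ {n} → isNode ⊢ leaf n ⇓ leaf 0 within 3 · B
    isNode-leaf = ⇓then ⇓leaf ⇓const , *-monoʳ-≤ 3 (>-nonZero⁻¹ B)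

    isNode-node : ∀ {x y} → isNode ⊢ node x y ⇓ leaf 1 within 3 · B
    isNode-node = ⇓else ⇓node ⇓const , *-monoʳ-≤ 3 (>-nonZero⁻¹ B)

    -- Leaving the loop takes 6 units, but a whole round is charged, so that a list of length `n`
    -- costs `suc n * (16 + k)`.
    fold-[] : ∀ {p z k} → fold p ⊢ node (leaf 0) z ⇓ node (leaf 0) z within 1 * (16 + k) · B
    fold-[] {k = k} with r , b ← fst! {leaf 0} ⨾! isNode-leaf =
      ⇓stop r , ≤-trans (s≤s b) (≤-trans (+-monoˡ-≤ (5 * B) (>-nonZero⁻¹ B))
                  (*-monoˡ-≤ B {6} {1 * (16 + k)} (m≤m+n 6 _)))

    -- The 16 consists of 1 for the loop rule, 5 for the guard and 10 for rearranging the data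
    -- around `p`.
    fold-∷ : ∀ {p x xs a a′ z k n} →
             p ⊢ node x a ⇓ a′ within k · B →
             fold p ⊢ node xs a′ ⇓ z within n * (16 + k) · B →
             fold p ⊢ node (node x xs) a ⇓ z within suc n * (16 + k) · B
    fold-∷ {k = k} {n} step (r₃ , b₃)
      with r₁ , b₁ ← fst! ⨾! isNode-node
         | r₂ , b₂ ← ⟨ fst! ⨾! snd! , ⟨ fst! ⨾! fst! , snd! ⟩! ⨾! step ⟩! =
      ⇓loop r₁ r₂ r₃ , suc-+-bound {k = 15 + k} {n * (16 + k)} (+-bound {k = 5} {10 + k} b₁ b₂) b₃

  -- Moves the number of rounds, at most `B`, from the coefficient into the unit, so that the
  -- coefficient is again independent of the input.
  loop-bound : ∀ {p x y k n B} → p ⊢ x ⇓ y within suc n * k · B → n < B →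
               p ⊢ x ⇓ y within k · B * B
  loop-bound {k = k} {n} {B} (r , b) n<B = r , (begin
    _             ≤⟨ b ⟩
    suc n * k * B ≤⟨ *-monoˡ-≤ B {suc n * k} (*-monoˡ-≤ k n<B) ⟩
    B * k * B     ≡⟨ cong (_* B) (*-comm B k) ⟩
    k * B * B     ≡⟨ *-assoc k B B ⟩
    k * (B * B)   ∎)
    where open ≤-Reasoning

  -- Growth of numerators and denominators under summation

  encodeCosts : ∀ {n} → Vec ℚᵘ n → Tree
  encodeCosts = encodeVec encodeCost

  -- Unnormalised addition never reduces the fraction, and nonnegativity rules out cancellation
  -- between the numerators, so absolute values add.
  encodeCost-+ : ∀ {p q} → 0ℚᵘ ℚ.≤ p → 0ℚᵘ ℚ.≤ q →
    encodeCost (p ℚ.+ q) ≡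
    node (leaf (∣ ↥ p ∣ * ↧ₙ q + ∣ ↥ q ∣ * ↧ₙ p)) (leaf (↧ₙ p * ↧ₙ q))
  encodeCost-+ {mkℚᵘ (ℤ.+ a) d} {mkℚᵘ (ℤ.+ b) e} _ _ =
    cong (λ i → node (leaf ∣ i ∣) (leaf (suc d * suc e)))
      (cong₂ ℤ._+_ (sym (ℤ.pos-* a (suc e))) (sym (ℤ.pos-* b (suc d))))
  encodeCost-+ {mkℚᵘ -[1+ _ ] _} (ℚ.*≤* ())
  encodeCost-+ {mkℚᵘ (ℤ.+ _) _} {mkℚᵘ -[1+ _ ] _} _ (ℚ.*≤* ())

  -- Numerator and denominator are added before the length is taken, and one is added after, to make
  -- the measure subadditive under addition of nonnegative fractions.
  width : ℚᵘ → ℕ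
  width q = suc (bits (∣ ↥ q ∣ + ↧ₙ q))

  width≤size : ∀ q → width q ≤ suc (size (encodeCost q))
  width≤size q = s≤s (bits-+ ∣ ↥ q ∣ (↧ₙ q))

  -- a/d + b/e = (ae + bd)/(de), and (ae + bd) + de ≤ (a + d)(b + e).
  width-+ : ∀ {p q} → 0ℚᵘ ℚ.≤ p → 0ℚᵘ ℚ.≤ q → width (p ℚ.+ q) ≤ width p + width q
  width-+ {p} {q} 0≤p 0≤q = begin
    width (p ℚ.+ q)                                          ≡⟨ cong measure (encodeCost-+ 0≤p 0≤q) ⟩
    suc (bits (a * e + b * d + d * e))                       ≤⟨ s≤s (bits-mono (m≤n+m _ (a * b))) ⟩
    suc (bits (a * b + (a * e + b * d + d * e)))             ≡⟨ cong (λ k → suc (bits k)) (expand a b d e) ⟩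
    suc (bits ((a + d) * (b + e)))                           ≤⟨ s≤s (bits-* (a + d) (b + e)) ⟩
    suc (suc (bits (a + d) + bits (b + e)))                  ≡⟨ cong suc (+-suc (bits (a + d)) (bits (b + e))) ⟨
    width p + width q                                        ∎
    where
    open ≤-Reasoning
    a = ∣ ↥ p ∣
    d = ↧ₙ p
    b = ∣ ↥ q ∣
    e = ↧ₙ q
    measure : Tree → ℕ
    measure (node (leaf m) (leaf n)) = suc (bits (m + n))
    measure _                        = 0
    expand : ∀ a b d e → a * b + (a * e + b * d + d * e) ≡ (a + d) * (b + e)
    expand = solve-∀

  Moderate : ℕ → ℚᵘ → Set
  Moderate B q = 0ℚᵘ ℚ.≤ q × width q ≤ B

  moderate-+ : ∀ {A B p q} → Moderate A p → Moderate B q → Moderate (A + B) (p ℚ.+ q)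
  moderate-+ (0≤p , wp) (0≤q , wq) =
    ℚ.+-mono-≤ 0≤p 0≤q , ≤-trans (width-+ 0≤p 0≤q) (+-mono-≤ wp wq)

  moderate-weaken : ∀ {A B q} → A ≤ B → Moderate A q → Moderate B q
  moderate-weaken A≤B (0≤q , w) = 0≤q , ≤-trans w A≤B

  moderate-zipWith-+ : ∀ {A B n} {ps qs : Vec ℚᵘ n} →
    All (Moderate A) ps → All (Moderate B) qs → All (Moderate (A + B)) (zipWith ℚ._+_ ps qs)
  moderate-zipWith-+ []         []         = []
  moderate-zipWith-+ (mp ∷ mps) (mq ∷ mqs) = moderate-+ mp mq ∷ moderate-zipWith-+ mps mqs

  moderate-row : ∀ {n} {qs : Vec ℚᵘ n} → NonNegativeCosts qs → All (Moderate (size (encodeCosts qs))) qs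
  moderate-row []                       = []
  moderate-row {qs = q ∷ qs} (0≤q ∷ 0≤qs) =
    -- The `node` holding `q` in the list supplies the `suc` of `width≤size`.
    (0≤q , ≤-trans (width≤size q) (s≤s (m≤m+n _ _))) ∷
    All.map (moderate-weaken (m≤n⇒m≤1+n (m≤n+m _ (size (encodeCost q))))) (moderate-row 0≤qs)

  -- Preserves the loop invariant: the width bound `A` of the accumulator plus the size of the
  -- remaining rows is at most `B`. Adding `c` moves its size from the second summand to the first.
  absorb : ∀ {A B n k} (c : Vec ℚᵘ n) (cs : Vec (Vec ℚᵘ n) k) →
    A + size (encodeVec encodeCosts (c ∷ cs)) ≤ B →
    size (encodeCosts c) + A + size (encodeVec encodeCosts cs) ≤ B
  absorb {A} c cs = ≤-trans (begin
    x + A + y         ≡⟨ cong (_+ y) (+-comm x A) ⟩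
    A + x + y         ≡⟨ +-assoc A x y ⟩
    A + (x + y)       ≤⟨ +-monoʳ-≤ A (n≤1+n (x + y)) ⟩
    A + suc (x + y)   ∎)
    where
    open ≤-Reasoning
    x = size (encodeCosts c)
    y = size (encodeVec encodeCosts cs)

  moderate-sumCosts : ∀ {A B n k} {acc : Vec ℚᵘ n} {cs : Vec (Vec ℚᵘ n) k} →
    All (Moderate A) acc → All NonNegativeCosts cs → A + size (encodeVec encodeCosts cs) ≤ B →
    All (Moderate B) (sumCosts acc cs)
  moderate-sumCosts {cs = []} ms [] A+1≤B = All.map (moderate-weaken (≤-trans (m≤m+n _ 1) A+1≤B)) ms
  moderate-sumCosts {cs = c ∷ cs} ms (0≤c ∷ 0≤cs) A+c+cs≤B =
    moderate-sumCosts {cs = cs} (moderate-zipWith-+ (moderate-row 0≤c) ms) 0≤cs (absorb c cs A+c+cs≤B)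

  size-moderate : ∀ {B} q → Moderate B q → size (encodeCost q) ≤ 2 * B
  size-moderate {B} q (_ , w) = begin
    suc (bits a + bits d)   ≤⟨ +-mono-≤ (≤-trans (s≤s (bits-mono (m≤m+n a d))) w)
                                        (≤-trans (m≤n⇒m≤1+n (bits-mono (m≤n+m d a))) w) ⟩
    B + B                   ≡⟨ cong (B +_) (+-identityʳ B) ⟨
    2 * B                   ∎
    where
    open ≤-Reasoning
    a = ∣ ↥ q ∣
    d = ↧ₙ q

  size-costs : ∀ {B n} {qs : Vec ℚᵘ n} → All (Moderate B) qs → size (encodeCosts qs) ≤ suc n * suc (2 * B)
  size-costs []                    = s≤s z≤n
  size-costs {qs = q ∷ _} (m ∷ ms) = s≤s (+-mono-≤ (size-moderate q m) (size-costs ms))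

  -- Programs that add fractions, rows and scenarios

  -- Maps ((a , d) , (b , e)) to (ae + bd , de).
  addCosts : Program
  addCosts = ⟨ ⟨ ⟨ fst ⨾ fst , snd ⨾ snd ⟩ ⨾ mul , ⟨ snd ⨾ fst , fst ⨾ snd ⟩ ⨾ mul ⟩ ⨾ add
             , ⟨ fst ⨾ snd , snd ⨾ snd ⟩ ⨾ mul ⟩

  -- (x, (y ∷ ys, out)) ↦ (ys, x + y ∷ out)
  addHead : Program
  addHead = ⟨ snd ⨾ fst ⨾ snd , ⟨ ⟨ fst , snd ⨾ fst ⨾ fst ⟩ ⨾ addCosts , snd ⨾ snd ⟩ ⟩

  -- The first fold pushes the sums onto its output in reverse order. `fold skip` pushes each head
  -- onto the accumulator and thereby restores the order.
  addRows : Program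
  addRows = ⟨ fst , ⟨ snd , const 0 ⟩ ⟩ ⨾ fold addHead ⨾ ⟨ snd ⨾ snd , const 0 ⟩ ⨾ fold skip ⨾ snd

  -- (S, c ∷ cs) ↦ (S, the sum of c and cs)
  aggregate : Program
  aggregate = ⟨ fst , ⟨ snd ⨾ snd , snd ⨾ fst ⟩ ⨾ fold addRows ⨾ snd ⟩

  module _ {B : ℕ} .{{_ : NonZero B}} where

    addCosts! : ∀ {p q} → Moderate B p → Moderate B q →
      addCosts ⊢ node (encodeCost p) (encodeCost q) ⇓ encodeCost (p ℚ.+ q) within 39 · B
    addCosts! {p} {q} (0≤p , wp) (0≤q , wq) =
      subst (λ t → addCosts ⊢ node (encodeCost p) (encodeCost q) ⇓ t within 39 · B)
        (sym (encodeCost-+ 0≤p 0≤q))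
        ⟨ ⟨ ⟨ fst! ⨾! fst! , snd! ⨾! snd! ⟩! ⨾! mul! {k = 1} {1} num-p den-q
          , ⟨ snd! ⨾! fst! , fst! ⨾! snd! ⟩! ⨾! mul! {k = 1} {1} num-q den-p ⟩!
          -- By `bits-*` each product has at most `2 * B + 1` bits, hence at most 3 units.
          ⨾! add! {k = 3} {3} (product ∣ ↥ p ∣ (↧ₙ q) num-p den-q) (product ∣ ↥ q ∣ (↧ₙ p) num-q den-p)
        , ⟨ fst! ⨾! snd! , snd! ⨾! snd! ⟩! ⨾! mul! {k = 1} {1} den-p den-q ⟩!
      where
      toUnit : ∀ {n} → n ≤ B → n ≤ 1 * B
      toUnit n≤B = ≤-trans n≤B (≤-reflexive (sym (*-identityˡ B)))

      numerator : ∀ q → width q ≤ B → bits ∣ ↥ q ∣ ≤ 1 * B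
      numerator q w = toUnit (≤-trans (≤-trans (bits-mono (m≤m+n ∣ ↥ q ∣ (↧ₙ q))) (n≤1+n _)) w)

      denominator : ∀ q → width q ≤ B → bits (↧ₙ q) ≤ 1 * B
      denominator q w = toUnit (≤-trans (≤-trans (bits-mono (m≤n+m (↧ₙ q) ∣ ↥ q ∣)) (n≤1+n _)) w)

      num-p = numerator p wp
      num-q = numerator q wq
      den-p = denominator p wp
      den-q = denominator q wq

      product : ∀ m n → bits m ≤ 1 * B → bits n ≤ 1 * B → bits (m * n) ≤ 3 * B
      product m n i j = ≤-trans (bits-* m n) (+-mono-≤ (>-nonZero⁻¹ B) (≤-trans (+-mono-≤ i j)
        (≤-reflexive (sym (*-distribʳ-+ B 1 1)))))

    addHead! : ∀ {n p q} {qs : Vec ℚᵘ n} {out} → Moderate B p → Moderate B q →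
      addHead ⊢ node (encodeCost p) (node (encodeCosts (q ∷ qs)) out)
              ⇓ node (encodeCosts qs) (node (encodeCost (p ℚ.+ q)) out) within 57 · B
    addHead! mp mq =
      ⟨ snd! ⨾! fst! ⨾! snd! , ⟨ ⟨ fst! , snd! ⨾! fst! ⨾! fst! ⟩! ⨾! addCosts! mp mq , snd! ⨾! snd! ⟩! ⟩!

    zip! : ∀ {n} (ps qs : Vec ℚᵘ n) out → All (Moderate B) ps → All (Moderate B) qs →
      fold addHead
        ⊢ node (encodeCosts ps) (node (encodeCosts qs) (encodeList encodeCost out))
        ⇓ node (leaf 0) (node (leaf 0) (encodeList encodeCost (toList (zipWith ℚ._+_ ps qs) ʳ++ out)))
        within suc n * 73 · B
    zip! []       []       out []         []         = fold-[] {k = 57}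
    zip! {suc n} (p ∷ ps) (q ∷ qs) out (mp ∷ mps) (mq ∷ mqs) =
      fold-∷ {n = suc n} (addHead! {qs = qs} mp mq) (zip! ps qs (p ℚ.+ q ∷ out) mps mqs)

    reverse! : ∀ (qs out : List ℚᵘ) →
      fold skip
        ⊢ node (encodeList encodeCost qs) (encodeList encodeCost out)
        ⇓ node (leaf 0) (encodeList encodeCost (qs ʳ++ out))
        within suc (length qs) * 17 · B
    reverse! []       out = fold-[] {k = 1}
    reverse! (q ∷ qs) out = fold-∷ {n = suc (length qs)} skip! (reverse! qs (q ∷ out))

  module _ {B : ℕ} .{{B≢0 : NonZero B}} where

    private instance
      B²≢0 : NonZero (B * B)
      B²≢0 = m*n≢0 B B

    -- Each of the two folds makes at most `B` rounds, counting the exit, at a constant number of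
    -- units per round; hence the unit `B * B`.
    addRows! : ∀ {n} (ps qs : Vec ℚᵘ n) → All (Moderate B) ps → All (Moderate B) qs → n < B →
      addRows ⊢ node (encodeCosts ps) (encodeCosts qs) ⇓ encodeCosts (zipWith ℚ._+_ ps qs)
      within 105 · (B * B)
    addRows! {n} ps qs mps mqs n<B =
      ⟨ fst! , ⟨ snd! , const! ⟩! ⟩!
      ⨾! loop-bound {k = 73} {n} {B} (zip! ps qs [] mps mqs) n<B
      ⨾! ⟨ snd! ⨾! snd! , const! ⟩!
      ⨾! subst (λ xs → fold skip ⊢ node (encodeList encodeCost (List.reverse rs)) (leaf 0)
                         ⇓ node (leaf 0) (encodeList encodeCost xs) within 17 · (B * B))
           (reverse-involutive rs)
           (loop-bound {k = 17} (reverse! (List.reverse rs) [])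
             (subst (_< B) (sym (trans (length-reverse rs) (length-toList (zipWith ℚ._+_ ps qs)))) n<B))
      ⨾! snd!
      where rs = toList (zipWith ℚ._+_ ps qs)

    -- `A` grows with every row added, while `absorb` keeps the invariant; so all calls of `addRows`
    -- meet only fractions of width at most the same `B`.
    sumRows! : ∀ {A n k} (acc : Vec ℚᵘ n) (cs : Vec (Vec ℚᵘ n) k) → n < B →
      All (Moderate A) acc → All NonNegativeCosts cs → A + size (encodeVec encodeCosts cs) ≤ B →
      fold addRows
        ⊢ node (encodeVec encodeCosts cs) (encodeCosts acc)
        ⇓ node (leaf 0) (encodeCosts (sumCosts acc cs))
        within suc k * 121 · (B * B)
    sumRows! acc [] _ _ _ _ = fold-[] {k = 105}
    sumRows! {A} {k = suc k} acc (c ∷ cs) n<B ms (0≤c ∷ 0≤cs) A+c+cs≤B =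
      fold-∷ {n = suc k}
        (addRows! c acc
          (All.map (moderate-weaken (≤-trans (m≤m+n x (A + y)) x+A+y≤B)) (moderate-row 0≤c))
          (All.map (moderate-weaken (≤-trans (m≤m+n A _) A+c+cs≤B)) ms) n<B)
        (sumRows! (zipWith ℚ._+_ c acc) cs n<B (moderate-zipWith-+ (moderate-row 0≤c) ms) 0≤cs
          (absorb c cs A+c+cs≤B))
      where
      x = size (encodeCosts c)
      y = size (encodeVec encodeCosts cs)
      x+A+y≤B = ≤-trans (≤-reflexive (sym (+-assoc x A y))) (absorb c cs A+c+cs≤B)

  -- Time and output size of the aggregation in terms of the input size

  module _ (S : Tree) {n k} (c : Vec ℚᵘ n) (cs : Vec (Vec ℚᵘ n) k)
           (0≤c : NonNegativeCosts c) (0≤cs : All NonNegativeCosts cs) where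

    private
      N = size (node S (encodeVec encodeCosts (c ∷ cs)))

      rows<N : size (encodeVec encodeCosts (c ∷ cs)) < N
      rows<N = s≤s (m≤n+m _ (size S))

      c+cs<N : size (encodeCosts c) + size (encodeVec encodeCosts cs) < N
      c+cs<N = <-trans (n<1+n _) rows<N

      n<N : n < N
      n<N = <-trans (≤-trans (length<size encodeCost c) (m≤m+n (size (encodeCosts c)) _)) c+cs<N

      k<N : k < N
      k<N = <-trans (≤-trans (length<size encodeCosts cs) (m≤n+m _ (size (encodeCosts c)))) c+cs<N

      instance
        N²≢0 : NonZero (N * N)
        N²≢0 = m*n≢0 N N
        N⁴≢0 : NonZero (N * N * (N * N))
        N⁴≢0 = m*n≢0 (N * N) (N * N)

    -- A row costs a multiple of `N * N`. The number of rounds is bounded generously by `N * N` too,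
    -- so that `loop-bound` applies to this unit.
    aggregate! : aggregate
      ⊢ node S (encodeVec encodeCosts (c ∷ cs)) ⇓ node S (encodeCosts (sumCosts c cs))
      within 133 · (N * N * (N * N))
    aggregate! = ⟨ fst! , ⟨ snd! ⨾! snd! , snd! ⨾! fst! ⟩!
      ⨾! loop-bound {k = 121} {k} {N * N} (sumRows! c cs n<N (moderate-row 0≤c) 0≤cs (<⇒≤ c+cs<N))
           (<-≤-trans k<N (m≤m*n N N)) ⨾! snd! ⟩!

    moderate-aggregate : All (Moderate N) (sumCosts c cs)
    moderate-aggregate = moderate-sumCosts (moderate-row 0≤c) 0≤cs (<⇒≤ c+cs<N)

    -- Fewer than `N` entries, each of width at most `N`, make the output quadratic in `N`.
    size-aggregate : size (node S (encodeCosts (sumCosts c cs))) ≤ 4 * (N * N)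
    size-aggregate = begin
      suc (size S) + size (encodeCosts (sumCosts c cs))
        ≤⟨ +-mono-≤ (s≤s (m≤m+n (size S) _)) (size-costs moderate-aggregate) ⟩
      N + suc n * suc (2 * N)   ≤⟨ +-mono-≤ (m≤m*n N N) (*-mono-≤ n<N (+-monoˡ-≤ (2 * N) (>-nonZero⁻¹ N))) ⟩
      N * N + N * (3 * N)       ≡⟨ collect N ⟩
      4 * (N * N)               ∎
      where
      open ≤-Reasoning
      collect : ∀ N → N * N + N * (3 * N) ≡ 4 * (N * N)
      collect = solve-∀

  ^-distribʳ-* : ∀ d m n → (m * n) ^ d ≡ m ^ d * n ^ d
  ^-distribʳ-* zero    m n = refl
  ^-distribʳ-* (suc d) m n = begin
    m * n * (m * n) ^ d       ≡⟨ cong (m * n *_) (^-distribʳ-* d m n) ⟩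
    m * n * (m ^ d * n ^ d)   ≡⟨ [m*n]*[o*p]≡[m*o]*[n*p] m n (m ^ d) (n ^ d) ⟩
    m * m ^ d * (n * n ^ d)   ∎
    where open ≡-Reasoning

  -- Bounds a program of time `a` times N⁴ followed by one of time `t` whose input has size at most
  -- `b` times N². The outer `suc` is the cost of sequencing and is absorbed into `suc a`.
  polynomial-bound : ∀ {a b c N t} d .{{_ : NonZero N}} →
    t ≤ c * (b * (N * N)) ^ d →
    suc (a * (N * N * (N * N)) + t) ≤ (suc a + c * b ^ d) * N ^ (4 + 2 * d)
  polynomial-bound {a} {b} {c} {N} {t} d t≤ = begin
    suc (a * (N * N * (N * N)) + t)                       ≤⟨ +-mono-≤ (m^n>0 N 4) (+-monoʳ-≤ _ t≤) ⟩
    N ^ 4 + (a * (N * N * (N * N)) + c * (b * (N * N)) ^ d)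
      ≡⟨ cong₂ (λ x y → N ^ 4 + (a * x + c * y)) (fourth N) power ⟩
    N ^ 4 + (a * N ^ 4 + c * (b ^ d * N ^ (2 * d)))       ≡⟨ regroup (N ^ 4) a c (b ^ d) (N ^ (2 * d)) ⟩
    suc a * N ^ 4 + c * b ^ d * N ^ (2 * d)
      ≤⟨ +-mono-≤ (*-monoʳ-≤ (suc a) (^-monoʳ-≤ N (m≤m+n 4 (2 * d))))
                  (*-monoʳ-≤ (c * b ^ d) (^-monoʳ-≤ N (m≤n+m (2 * d) 4))) ⟩
    suc a * N ^ (4 + 2 * d) + c * b ^ d * N ^ (4 + 2 * d) ≡⟨ *-distribʳ-+ (N ^ (4 + 2 * d)) (suc a) (c * b ^ d) ⟨
    (suc a + c * b ^ d) * N ^ (4 + 2 * d)                 ∎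
    where
    open ≤-Reasoning
    fourth : ∀ N → N * N * (N * N) ≡ N * (N * (N * (N * 1)))
    fourth = solve-∀
    regroup : ∀ x a c y z → x + (a * x + c * (y * z)) ≡ suc a * x + c * y * z
    regroup = solve-∀
    power : (b * (N * N)) ^ d ≡ b ^ d * N ^ (2 * d)
    power = trans (^-distribʳ-* d b (N * N))
      (cong (b ^ d *_) (trans (cong (λ x → (N * x) ^ d) (sym (*-identityʳ N))) (^-*-assoc N 2 d)))

module Approximation where
  open import Data.Integer.Base as ℤ using ()
  import Data.Integer.Properties as ℤ
  open import Data.Rational.Unnormalised.Base
  open import Data.Rational.Unnormalised.Properties
  open import Data.Rational.Unnormalised.Solver using (module +-*-Solver)
  open +-*-Solver using (solve; _:=_; _:+_; _:*_; _:-_; con)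
  open import Data.Sum.Base using (inj₁; inj₂)
  open import Data.Vec.Relation.Unary.All.Properties using (map⁺)

  -- Order on rationals and on constant reals

  0≤*0≤ : ∀ {p q} → 0ℚᵘ ≤ p → 0ℚᵘ ≤ q → 0ℚᵘ ≤ p * q
  0≤*0≤ {p} {q} 0≤p 0≤q = ≤-respˡ-≃ (*-zeroˡ q) (*-monoˡ-≤-nonNeg q {{nonNegative 0≤q}} 0≤p)

  ≤-by-difference : ∀ {p q r} → q - p ≃ r → 0ℚᵘ ≤ r → p ≤ q
  ≤-by-difference q-p≃r 0≤r = 0≤q-p⇒p≤q (≤-respʳ-≃ (≃-sym q-p≃r) 0≤r)

  -- Otherwise density gives `r` strictly between `q` and `p`, and `ε = r - q` yields a
  -- contradiction.
  ≤+ε⇒≤ : ∀ {p q} → (∀ ε → 0ℚᵘ < ε → p ≤ q + ε) → p ≤ q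
  ≤+ε⇒≤ {p} {q} p≤q+ε = ≮⇒≥ λ q<p →
    let r , q<r , r<p = <-dense q<p in
    <⇒≱ r<p (≤-respʳ-≃ (cancel q r) (p≤q+ε (r - q) (<-respˡ-≃ (+-inverseʳ q) (+-monoˡ-< (- q) q<r))))
    where
    cancel : ∀ q r → q + (r - q) ≃ r
    cancel = solve 2 (λ q r → q :+ (r :- q) := r) ≃-refl

  fromℚ-≤ᴿ⁻¹ : ∀ {p q} → fromℚ p ≤ᴿ fromℚ q → p ≤ q
  fromℚ-≤ᴿ⁻¹ p≤q = ≤+ε⇒≤ λ ε 0<ε → let N , h = p≤q ε 0<ε in h {N} ℕ.≤-refl

  -- Sums compared with maximum and minimum

  minimum≤maximum : ∀ {k} (xs : Vec ℚᵘ (suc k)) → minimum xs ≤ maximum xs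
  minimum≤maximum (x ∷ [])         = ≤-refl
  minimum≤maximum (x ∷ xs@(_ ∷ _)) =
    ≤-trans (p⊓q≤q x (minimum xs)) (≤-trans (minimum≤maximum xs) (p≤q⊔p x (maximum xs)))

  0≤minimum : ∀ {k} {xs : Vec ℚᵘ (suc k)} → All (0ℚᵘ ≤_) xs → 0ℚᵘ ≤ minimum xs
  0≤minimum (0≤x ∷ [])            = 0≤x
  0≤minimum (0≤x ∷ 0≤xs@(_ ∷ _)) = ⊓-glb 0≤x (0≤minimum 0≤xs)

  sumᵛ : ∀ {k} → Vec ℚᵘ k → ℚᵘ
  sumᵛ = Vec.foldr′ _+_ 0ℚᵘ

  fromℕᵘ : ℕ → ℚᵘ
  fromℕᵘ k = ℤ.+ k / 1

  fromℕᵘ-suc : ∀ k → fromℕᵘ (suc k) ≃ 1ℚᵘ + fromℕᵘ k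
  fromℕᵘ-suc k = *≡* (cong (ℤ._* ℤ.+ 1) (cong ℤ.suc (sym (ℤ.*-identityʳ (ℤ.+ k)))))

  0≤fromℕᵘ : ∀ k → 0ℚᵘ ≤ fromℕᵘ k
  0≤fromℕᵘ k = nonNegative⁻¹ (fromℕᵘ k)

  -- Used with `y` and `z` the extrema of the tail: the new maximum is `z` or `x`, and the minimum
  -- is then bounded by the other one.
  ⊔+⊓≤ : ∀ {x y z} → y ≤ z → (x ⊔ z) + (x ⊓ y) ≤ x + z
  ⊔+⊓≤ {x} {y} {z} y≤z with ≤-total x z
  ... | inj₁ x≤z = ≤-respʳ-≃ (+-comm z x) (+-mono-≤ (≤-reflexive (p≤q⇒p⊔q≃q x≤z)) (p⊓q≤p x y))
  ... | inj₂ z≤x = +-mono-≤ (≤-reflexive (p≥q⇒p⊔q≃p z≤x)) (≤-trans (p⊓q≤q x y) y≤z)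

  ≤⊔+⊓ : ∀ {x y z} → y ≤ z → x + y ≤ (x ⊔ z) + (x ⊓ y)
  ≤⊔+⊓ {x} {y} {z} y≤z with ≤-total x y
  ... | inj₁ x≤y = ≤-respˡ-≃ (+-comm y x)
    (+-mono-≤ (≤-trans y≤z (p≤q⊔p x z)) (≤-reflexive (≃-sym (p≤q⇒p⊓q≃p x≤y))))
  ... | inj₂ y≤x = +-mono-≤ (p≤p⊔q x z) (≤-reflexive (≃-sym (p≥q⇒p⊓q≃q y≤x)))

  -- One entry is the maximum and the other `k` are at least the minimum; induction avoids singling
  -- that entry out.
  maximum+minimum≤sum : ∀ {k} (xs : Vec ℚᵘ (suc k)) →
    maximum xs + fromℕᵘ k * minimum xs ≤ sumᵛ xs
  maximum+minimum≤sum (x ∷ []) = ≤-reflexive (+-congʳ x (*-zeroˡ x))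
  maximum+minimum≤sum {suc k} (x ∷ xs@(_ ∷ _)) = begin
    (x ⊔ M) + fromℕᵘ (suc k) * w          ≃⟨ +-congʳ (x ⊔ M) (*-congʳ {w} (fromℕᵘ-suc k)) ⟩
    (x ⊔ M) + (1ℚᵘ + fromℕᵘ k) * w        ≃⟨ regroup (x ⊔ M) (fromℕᵘ k) w ⟩
    ((x ⊔ M) + w) + fromℕᵘ k * w          ≤⟨ +-mono-≤ (⊔+⊓≤ {x} (minimum≤maximum xs))
                                               (*-monoʳ-≤-nonNeg (fromℕᵘ k) {{nonNegative (0≤fromℕᵘ k)}} (p⊓q≤q x m)) ⟩
    (x + M) + fromℕᵘ k * m                ≃⟨ +-assoc x M _ ⟩
    x + (M + fromℕᵘ k * m)                ≤⟨ +-monoʳ-≤ x (maximum+minimum≤sum xs) ⟩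
    x + sumᵛ xs                           ∎
    where
    open ≤-Reasoning
    M = maximum xs
    m = minimum xs
    w = x ⊓ m
    regroup : ∀ p k w → p + (1ℚᵘ + k) * w ≃ (p + w) + k * w
    regroup = solve 3 (λ p k w → p :+ (con 1ℚᵘ :+ k) :* w := (p :+ w) :+ k :* w) ≃-refl

  sum≤maximum+minimum : ∀ {k} (xs : Vec ℚᵘ (suc k)) →
    sumᵛ xs ≤ fromℕᵘ k * maximum xs + minimum xs
  sum≤maximum+minimum (x ∷ []) = ≤-reflexive (≃-trans (+-comm x 0ℚᵘ) (+-congˡ x (≃-sym (*-zeroˡ x))))
  sum≤maximum+minimum {suc k} (x ∷ xs@(_ ∷ _)) = begin
    x + sumᵛ xs                           ≤⟨ +-monoʳ-≤ x (sum≤maximum+minimum xs) ⟩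
    x + (fromℕᵘ k * M + m)                ≃⟨ exchange x (fromℕᵘ k * M) m ⟩
    fromℕᵘ k * M + (x + m)                ≤⟨ +-mono-≤ (*-monoʳ-≤-nonNeg (fromℕᵘ k) {{nonNegative (0≤fromℕᵘ k)}} (p≤q⊔p x M))
                                               (≤⊔+⊓ {x} (minimum≤maximum xs)) ⟩
    fromℕᵘ k * w + (w + (x ⊓ m))          ≃⟨ regroup (fromℕᵘ k) w (x ⊓ m) ⟩
    (1ℚᵘ + fromℕᵘ k) * w + (x ⊓ m)        ≃⟨ +-congˡ (x ⊓ m) (*-congʳ {w} (fromℕᵘ-suc k)) ⟨
    fromℕᵘ (suc k) * w + (x ⊓ m)          ∎
    where
    open ≤-Reasoning
    M = maximum xs
    m = minimum xs
    w = x ⊔ M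
    exchange : ∀ x y z → x + (y + z) ≃ y + (x + z)
    exchange = solve 3 (λ x y z → x :+ (y :+ z) := y :+ (x :+ z)) ≃-refl
    regroup : ∀ k w m → k * w + (w + m) ≃ (1ℚᵘ + k) * w + m
    regroup = solve 3 (λ k w m → k :* w :+ (w :+ m) := (con 1ℚᵘ :+ k) :* w :+ m) ≃-refl

  -- The Hurwicz inequality for approximations of α

  2ℚᵘ 4ℚᵘ : ℚᵘ
  2ℚᵘ = fromℕᵘ 2
  4ℚᵘ = fromℕᵘ 4

  -- Coefficient of the error `δ`. It is free of α, so `δ` can be fixed before the approximation of
  -- α is; the term `2ℚᵘ * (δ * (2ℚᵘ - α))` in `hurwicz-identity` serves to make it so.
  slack : (K m M′ m′ : ℚᵘ) → ℚᵘ
  slack K m M′ m′ = 2ℚᵘ * m + 4ℚᵘ * (M′ - m′) + (K - 2ℚᵘ) * m′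

  ratio : (α K : ℚᵘ) → ℚᵘ
  ratio α K = α * K + (1ℚᵘ - α) * (K - 2ℚᵘ)

  -- If ½ - δ ≤ α ≤ 1 + δ, every factor on the right is nonnegative.
  hurwicz-identity : ∀ α δ K M m M′ m′ →
    ratio α K * (α * M′ + (1ℚᵘ - α) * m′) + δ * slack K m M′ m′ - (α * M + (1ℚᵘ - α) * m) ≃
      α * ((K - 1ℚᵘ) * M′ + m′ - (M + (K - 1ℚᵘ) * m))
      + ((K - 2ℚᵘ) * α + (2ℚᵘ * (α + δ) - 1ℚᵘ)) * m
      + (α * (2ℚᵘ * (α + δ) - 1ℚᵘ) + 2ℚᵘ * (δ * (2ℚᵘ - α))) * (M′ - m′)
      + (K - 2ℚᵘ) * (1ℚᵘ + δ - α) * m′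
  hurwicz-identity = solve 7 (λ α δ K M m M′ m′ →
    let one = con 1ℚᵘ ; two = con 2ℚᵘ ; four = con 4ℚᵘ in
    (α :* K :+ (one :- α) :* (K :- two)) :* (α :* M′ :+ (one :- α) :* m′)
      :+ δ :* (two :* m :+ four :* (M′ :- m′) :+ (K :- two) :* m′)
      :- (α :* M :+ (one :- α) :* m)
    :=
      α :* ((K :- one) :* M′ :+ m′ :- (M :+ (K :- one) :* m))
      :+ ((K :- two) :* α :+ (two :* (α :+ δ) :- one)) :* m
      :+ (α :* (two :* (α :+ δ) :- one) :+ two :* (δ :* (two :- α))) :* (M′ :- m′)
      :+ (K :- two) :* (one :+ δ :- α) :* m′) ≃-refl

  -- The bound `δ ≤ ½` keeps `α` between 0 and 2, which the signs in `hurwicz-identity` require.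
  hurwicz-bound : ∀ {α δ ε K M m M′ m′} →
    0ℚᵘ ≤ δ → δ ≤ ½ → ½ ≤ α + δ → α ≤ 1ℚᵘ + δ → 2ℚᵘ ≤ K →
    0ℚᵘ ≤ m → 0ℚᵘ ≤ m′ → m′ ≤ M′ →
    M + (K - 1ℚᵘ) * m ≤ (K - 1ℚᵘ) * M′ + m′ → δ * slack K m M′ m′ ≤ ε →
    α * M + (1ℚᵘ - α) * m ≤ ratio α K * (α * M′ + (1ℚᵘ - α) * m′) + ε
  hurwicz-bound {α} {δ} {_} {K} {M} {m} {M′} {m′} 0≤δ δ≤½ ½≤α+δ α≤1+δ 2≤K 0≤m 0≤m′ m′≤M′ sums slack≤ε =
    ≤-trans (≤-by-difference (hurwicz-identity α δ K M m M′ m′)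
      (+-mono-≤ (+-mono-≤ (+-mono-≤
        (0≤*0≤ 0≤α (p≤q⇒0≤q-p sums))
        (0≤*0≤ (+-mono-≤ (0≤*0≤ 0≤K-2 0≤α) 0≤2α+2δ-1) 0≤m))
        (0≤*0≤ (+-mono-≤ (0≤*0≤ 0≤α 0≤2α+2δ-1) (0≤*0≤ (0≤fromℕᵘ 2) (0≤*0≤ 0≤δ 0≤2-α)))
               (p≤q⇒0≤q-p m′≤M′)))
        (0≤*0≤ (0≤*0≤ 0≤K-2 (p≤q⇒0≤q-p α≤1+δ)) 0≤m′)))
      (+-monoʳ-≤ (ratio α K * (α * M′ + (1ℚᵘ - α) * m′)) slack≤ε)
    where
    open ≤-Reasoning
    0≤K-2 : 0ℚᵘ ≤ K - 2ℚᵘ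
    0≤K-2 = p≤q⇒0≤q-p 2≤K
    cancel : ∀ α δ → α + δ - δ ≃ α
    cancel = solve 2 (λ α δ → α :+ δ :- δ := α) ≃-refl
    0≤α : 0ℚᵘ ≤ α
    0≤α = ≤-respʳ-≃ (cancel α δ) (p≤q⇒0≤q-p (≤-trans δ≤½ ½≤α+δ))
    0≤2α+2δ-1 : 0ℚᵘ ≤ 2ℚᵘ * (α + δ) - 1ℚᵘ
    0≤2α+2δ-1 = p≤q⇒0≤q-p (≤-respˡ-≃ {2ℚᵘ * (α + δ)} {2ℚᵘ * ½} {1ℚᵘ} (*≡* refl) (*-monoʳ-≤-nonNeg 2ℚᵘ ½≤α+δ))
    ½≤1 : ½ ≤ 1ℚᵘ
    ½≤1 = *≤* (ℤ.+≤+ (ℕ.s≤s ℕ.z≤n))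
    0≤2-α : 0ℚᵘ ≤ 2ℚᵘ - α
    0≤2-α = p≤q⇒0≤q-p (begin
      α          ≤⟨ α≤1+δ ⟩
      1ℚᵘ + δ    ≤⟨ +-monoʳ-≤ 1ℚᵘ (≤-trans δ≤½ ½≤1) ⟩
      2ℚᵘ        ∎)

  -- Takes the minimum of ½ and ε / (1 + C); the added 1 keeps the divisor positive when `C` is
  -- zero.
  tolerance : ∀ {C ε} → 0ℚᵘ ≤ C → 0ℚᵘ < ε → ∃ λ δ → 0ℚᵘ < δ × δ ≤ ½ × δ * C ≤ ε
  tolerance {C} {ε} 0≤C 0<ε = ½ ⊓ η , 0<½⊓η , p⊓q≤p ½ η , (begin
    (½ ⊓ η) * C          ≤⟨ *-monoˡ-≤-nonNeg C {{nonNegative 0≤C}} (p⊓q≤q ½ η) ⟩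
    η * C                ≤⟨ *-monoʳ-≤-nonNeg η {{nonNegative (<⇒≤ 0<η)}} (<⇒≤ C<1+C) ⟩
    1/ D * ε * D         ≃⟨ *-comm (1/ D * ε) D ⟩
    D * (1/ D * ε)       ≃⟨ *-assoc D (1/ D) ε ⟨
    D * 1/ D * ε         ≃⟨ *-congʳ (*-inverseʳ D) ⟩
    1ℚᵘ * ε              ≃⟨ *-identityˡ ε ⟩
    ε                    ∎)
    where
    open ≤-Reasoning
    D = 1ℚᵘ + C
    C<1+C : C < D
    C<1+C = <-respˡ-≃ (+-identityˡ C) (+-monoˡ-< C (positive⁻¹ 1ℚᵘ))
    instance
      D-pos : Positive D
      D-pos = positive (≤-<-trans 0≤C C<1+C)
      D-nonZero : NonZero D
      D-nonZero = pos⇒nonZero D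
      1/D-pos : Positive (1/ D)
      1/D-pos = 1/pos⇒pos D
    η = 1/ D * ε
    0<η : 0ℚᵘ < η
    0<η = <-respˡ-≃ (*-zeroʳ (1/ D)) (*-monoʳ-<-pos (1/ D) 0<ε)
    0<½⊓η : 0ℚᵘ < ½ ⊓ η
    0<½⊓η with ⊓-sel ½ η
    ... | inj₁ e = <-respʳ-≃ (≃-sym e) (positive⁻¹ ½)
    ... | inj₂ e = <-respʳ-≃ (≃-sym e) 0<η

  -- From optimality for the summed costs to the real Hurwicz objective

  F-nonNegative : ∀ {n} (X : Subset n) {c} → NonNegativeCosts c → 0ℚᵘ ≤ F X c
  F-nonNegative []            []           = ≤-refl
  F-nonNegative (inside  ∷ X) (0≤q ∷ 0≤qs) = +-mono-≤ 0≤q (F-nonNegative X 0≤qs)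
  F-nonNegative (outside ∷ X) (_   ∷ 0≤qs) = F-nonNegative X 0≤qs

  F-zipWith-+ : ∀ {n} (X : Subset n) b c → F X (Vec.zipWith _+_ b c) ≃ F X b + F X c
  F-zipWith-+ []            []       []       = ≃-refl
  F-zipWith-+ (outside ∷ X) (_ ∷ b) (_ ∷ c) = F-zipWith-+ X b c
  F-zipWith-+ (inside  ∷ X) (p ∷ b) (q ∷ c) =
    ≃-trans (+-congʳ (p + q) (F-zipWith-+ X b c)) (interchange p q (F X b) (F X c))
    where
    interchange : ∀ p q r s → p + q + (r + s) ≃ p + r + (q + s)
    interchange = solve 4 (λ p q r s → p :+ q :+ (r :+ s) := p :+ r :+ (q :+ s)) ≃-refl

  F-sumCosts : ∀ {n k} (X : Subset n) c (cs : Vec (Vec ℚᵘ n) k) →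
    F X (sumCosts c cs) ≃ sumᵛ (Vec.map (F X) (c ∷ cs))
  F-sumCosts X c []       = ≃-sym (+-identityʳ (F X c))
  F-sumCosts X c (d ∷ cs) = begin
    F X (sumCosts (Vec.zipWith _+_ d c) cs)   ≈⟨ F-sumCosts X (Vec.zipWith _+_ d c) cs ⟩
    F X (Vec.zipWith _+_ d c) + s             ≈⟨ +-congˡ s (F-zipWith-+ X d c) ⟩
    F X d + F X c + s                         ≈⟨ +-congˡ s (+-comm (F X d) (F X c)) ⟩
    F X c + F X d + s                         ≈⟨ +-assoc (F X c) (F X d) s ⟩
    F X c + (F X d + s)                       ∎
    where
    open import Relation.Binary.Reasoning.Setoid ≃-setoid
    s = sumᵛ (Vec.map (F X) cs)

  costs-nonNegative : ∀ {n k} (X : Subset n) {Γ : Vec (Vec ℚᵘ n) k} →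
    All NonNegativeCosts Γ → All (0ℚᵘ ≤_) (Vec.map (F X) Γ)
  costs-nonNegative X = map⁺ ∘ All.map (F-nonNegative X)

  -- The scenario costs are constant rationals, so `δ` depends only on them and `ε`; beyond both
  -- thresholds `hurwicz-bound` applies to each approximation of `α`.
  sumCosts-optimal⇒hurwicz : ∀ {n k} {X Y : Subset n} {c} {cs : Vec (Vec ℚᵘ n) (suc k)} {α} →
    fromℚ ½ ≤ᴿ α → α ≤ᴿ fromℕ 1 → All NonNegativeCosts (c ∷ cs) →
    F X (sumCosts c cs) ≤ F Y (sumCosts c cs) →
    let K = fromℕ (2 ℕ.+ k) in
    hurwicz α (c ∷ cs) X ≤ᴿ (α *ᴿ K +ᴿ (fromℕ 1 -ᴿ α) *ᴿ (K -ᴿ fromℕ 2)) *ᴿ hurwicz α (c ∷ cs) Y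
  sumCosts-optimal⇒hurwicz {k = k} {X} {Y} {c} {cs} {α} ½≤α α≤1 0≤Γ X≤Y ε 0<ε =
    let δ , 0<δ , δ≤½ , δC≤ε = tolerance 0≤slack 0<ε
        N₁ , ½≤α+δ = ½≤α δ 0<δ
        N₂ , α≤1+δ = α≤1 δ 0<δ
    in N₁ ℕ.⊔ N₂ , λ N≤n →
      hurwicz-bound (<⇒≤ 0<δ) δ≤½ (½≤α+δ (ℕ.m⊔n≤o⇒m≤o N₁ N₂ N≤n)) (α≤1+δ (ℕ.m⊔n≤o⇒n≤o N₁ N₂ N≤n))
        2≤K 0≤m 0≤m′ (minimum≤maximum ys) sums δC≤ε
    where
    xs = Vec.map (F X) (c ∷ cs)
    ys = Vec.map (F Y) (c ∷ cs)
    K = fromℕᵘ (2 ℕ.+ k)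
    M = maximum xs
    m = minimum xs
    M′ = maximum ys
    m′ = minimum ys

    0≤m : 0ℚᵘ ≤ m
    0≤m = 0≤minimum (costs-nonNegative X 0≤Γ)
    0≤m′ : 0ℚᵘ ≤ m′
    0≤m′ = 0≤minimum (costs-nonNegative Y 0≤Γ)

    2≤K : 2ℚᵘ ≤ K
    2≤K = *≤* (ℤ.*-monoʳ-≤-nonNeg (ℤ.+ 1) (ℤ.+≤+ (ℕ.m≤m+n 2 k)))

    0≤slack : 0ℚᵘ ≤ slack K m M′ m′
    0≤slack = +-mono-≤ (+-mono-≤ (0≤*0≤ (0≤fromℕᵘ 2) 0≤m)
                                 (0≤*0≤ (0≤fromℕᵘ 4) (p≤q⇒0≤q-p (minimum≤maximum ys))))
                       (0≤*0≤ (p≤q⇒0≤q-p 2≤K) 0≤m′)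

    K-1 : fromℕᵘ (suc k) ≃ K - 1ℚᵘ
    K-1 = ≃-trans (≃-sym (cancel (fromℕᵘ (suc k)))) (+-congˡ (- 1ℚᵘ) (≃-sym (fromℕᵘ-suc (suc k))))
      where
      cancel : ∀ p → 1ℚᵘ + p - 1ℚᵘ ≃ p
      cancel = solve 1 (λ p → con 1ℚᵘ :+ p :- con 1ℚᵘ := p) ≃-refl

    open ≤-Reasoning
    sums : M + (K - 1ℚᵘ) * m ≤ (K - 1ℚᵘ) * M′ + m′
    sums = begin
      M + (K - 1ℚᵘ) * m           ≃⟨ +-congʳ M (*-congʳ {m} K-1) ⟨
      M + fromℕᵘ (suc k) * m      ≤⟨ maximum+minimum≤sum xs ⟩
      sumᵛ xs                     ≃⟨ F-sumCosts X c cs ⟨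
      F X (sumCosts c cs)         ≤⟨ X≤Y ⟩
      F Y (sumCosts c cs)         ≃⟨ F-sumCosts Y c cs ⟩
      sumᵛ ys                     ≤⟨ sum≤maximum+minimum ys ⟩
      fromℕᵘ (suc k) * M′ + m′    ≃⟨ +-congˡ m′ (*-congʳ {M′} K-1) ⟩
      (K - 1ℚᵘ) * M′ + m′         ∎

-- Solving the summed instance

open Aggregation
open Approximation

corollary6 : (P : CombinatorialProblem) (α : ℝ) →
    fromℚ ½ ≤ᴿ α → α ≤ᴿ fromℕ 1 →
    PolynomiallySolvable (deterministic P) →
    ApproximableWithin (minHurwicz P α)
    (λ I → let K = fromℕ (scenarioCount P I) in
    α *ᴿ K +ᴿ (fromℕ 1 -ᴿ α) *ᴿ (K -ᴿ fromℕ 2))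
corollary6 P α ½≤α α≤1 (p , a , d , solves) =
  -- The constants are those of `polynomial-bound` for aggregation time 133 N⁴ and solver input of
  -- size at most 4 N².
  aggregate ⨾ p , 134 ℕ.+ a ℕ.* 4 ℕ.^ d , 4 ℕ.+ 2 ℕ.* d ,
  λ where
    record { structure = S ; Γ = c ∷ cs ; nonNegative = 0≤Γ@(0≤c ∷ 0≤cs) } →
      let T = encodeStructure S
          run = aggregate! T c cs 0≤c 0≤cs
          X , (ΦX , X-optimal) , t , r , b = solves record
            { structure   = S
            ; costs       = sumCosts c cs
            ; nonNegative = All.map proj₁ (moderate-aggregate T c cs 0≤c 0≤cs)
            }
      in
      X ,
      (ΦX , λ Y ΦY → sumCosts-optimal⇒hurwicz {X = X} {Y} {c} {cs} {α} ½≤α α≤1 0≤Γ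
                       (fromℚ-≤ᴿ⁻¹ {F X (sumCosts c cs)} (X-optimal Y ΦY))) ,
      suc (Run.time run ℕ.+ t) ,
      ⇓seq (Run.run run) r ,
      ℕ.≤-trans (ℕ.s≤s (ℕ.+-monoˡ-≤ t (Run.bound run)))
        (polynomial-bound {133} {4} {a} d
          (ℕ.≤-trans b (ℕ.*-monoʳ-≤ a (ℕ.^-monoˡ-≤ d (size-aggregate T c cs 0≤c 0≤cs)))))
  where
  open CombinatorialProblem P
  module Run = _⊢_⇓_within_·_
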